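{- For every $\tau\in T$, the algorithm $A_\tau$ computes $\tau$ in polynomial time (in $n$).
   Context: Universal hash family: a set $H$ of functions $h:U\to M$ such that for all $x\neq y$ in $U$, $\Pr_{h\in H}[h(x)=h(y)]\le 1/m$, where $m$ is the size of the range. The class $T$: it is the set of functions $\tau:\{0,1\}^n\to\{0,1\}^n$ constructed as follows. 1. Construct a sequence $(M_1,\dots,M_n)$ of $n$ pairwise distinct $n\times n$ matrices of random, uniformly distributed bits. 2. Pick randomly a sequence $H\tau_{row}=(h_{row1},\dots,h_{rown})$ of $n$ hash functions from a universal hash family $\{h:\{0,1\}^n\to\{0,1\}^{\log(n)}\}$. 3. Pick randomly a sequence $H\tau_{col}=(h_{col1},\dots,h_{coln})$ of $n$ hash functions from a universal hash family $\{h:\{0,1\}^n\to\{0,1\}^{\log(n)}\}$. 4. Construct an $n\times n$ matrix $H_M=(hd_{(i,j)})$ of hash functions picked randomly from a universal hash family $\{h:\{0,1\}^n\to\{0,1\}^3\}$. 5. Let $D$ be the $8\times 2$ matrix with rows, in order, $(1,0),(-1,0),(0,-1),(0,1),(-1,-1),(-1,1),(1,-1),(1,1)$. All the hash functions have the form $((ax+b)\bmod p)\bmod t$, where $p>2$ is an $n$-bit prime chosen at random, $a$ and $b$ are integers chosen at random with $0<a<p$ and $0<b<p$, and $t=n$ for members of $H\tau_{row}$ and $H\tau_{col}$, $t=8$ for members of $H_M$. Within each collection (sequence or matrix) of hash functions in $\tau$, any two distinct members $h_i,h_j$ satisfy $a_i\ne a_j$, $b_i\neq b_j$, $p_i\ne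 p_j$, and are independent in the sense that $(a_ix+b_i)\neq k(a_jx+b_j)$ for any integer $k>0$. The algorithm $A_\tau$, which defines $\tau(x)=y$: start with $y$ the empty binary sequence. For each $i=1,\dots,n$: let $r=h_{rowi}(x)+1$ and $c=h_{coli}(x)+1$; for each $j=1,\dots,n$, let $d=hd_{(i,j)}(x)+1$, replace $r$ by $r+D_{(d,1)}$ and $c$ by $c+D_{(d,2)}$, and then set any of $r,c$ that is less than $1$ equal to $n$ and any of $r,c$ that is greater than $n$ equal to $1$. After the loop over $j$, append the bit at coordinate $(r,c)$ of $M_i$ to $y$. Output $y$. -}

module Defs where

open import Data.Bool using (Bool; true; false; if_then_else_)
open import Data.Fin using (Fin; zero; suc; toℕ; fromℕ; fromℕ<; #_)
import Data.Fin as Fin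
open import Data.Integer using (ℤ; +_; -[1+_]; 0ℤ; 1ℤ; -1ℤ; ∣_∣; _%ℕ_)
import Data.Integer as ℤ
open import Data.List using (List; []; _∷_; _++_; allFin; filter; foldl; length)
import Data.List as List
open import Data.Nat using (ℕ; zero; suc; _+_; _*_; _^_; _≤_; _<_; _<?_; pred; NonZero)
open import Data.Nat.DivMod using (_%_; _mod_)
open import Data.Nat.Logarithm using (⌊log₂_⌋)
open import Data.Nat.Primality using (Prime; prime⇒nonZero)
open import Data.Product using (Σ; ∃; ∃-syntax; _×_; _,_; proj₁; proj₂)
open import Data.Vec using (Vec; []; _∷_; lookup; replicate; tabulate; toList; _[_]≔_)
open import Level using (0ℓ)
open import Relation.Binary.PropositionalEquality using (_≡_; _≢_; _≗_)
open import Relation.Nullary using (¬_; yes; no; does)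
open import Relation.Unary using (Pred)

------------------------------------------------------------------------
-- Bit sequences

Bits : ℕ → Set
Bits n = Vec Bool n

bit : Bool → ℕ
bit false = 0
bit true  = 1

-- The integer whose n-digit binary expansion, most significant bit first, is x.
value : ∀ {n} → Bits n → ℕ
value x = foldl (λ v b → 2 * v + bit b) 0 (toList x)

------------------------------------------------------------------------
-- Hash functions

-- {0,1}^(log t) is identified with {0,…,t-1}, i.e. with Fin t.  This also
-- makes sense when t is not a power of two.

collisions : ∀ {U : Set} {s t} → (Fin s → U → Fin t) → U → U → ℕ
collisions {s = s} h x y = length (filter (λ k → h k x Fin.≟ h k y) (allFin s))

record UniversalFamily (U : Set) (t : ℕ) : Set where
  field
    size      : ℕ
    nonEmpty  : NonZero size
    fun       : Fin size → U → Fin t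
    -- the family is a set: its members are listed without repetition
    distinct  : ∀ {k l} → fun k ≗ fun l → k ≡ l
    -- Pr[h x = h y] ≤ 1/t for uniform h, with denominators cleared
    universal : ∀ {x y} → x ≢ y → t * collisions fun x y ≤ size

_∈ᶠ_ : ∀ {U t} → (U → Fin t) → UniversalFamily U t → Set
h ∈ᶠ H = ∃[ k ] UniversalFamily.fun H k ≗ h

record LinearHash (n : ℕ) : Set where
  field
    a b p : ℕ
    prime : Prime p
    2<p   : 2 < p
    n-bit : 2 ^ pred n ≤ p × p < 2 ^ n
    0<a   : 0 < a
    a<p   : a < p
    0<b   : 0 < b
    b<p   : b < p

  hash : ∀ t .{{_ : NonZero t}} → Bits n → Fin t
  hash t x = (_%_ (a * value x + b) p {{prime⇒nonZero prime}}) mod t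

open LinearHash public using (hash)

record Independent {n} (g h : LinearHash n) : Set where
  private
    module G = LinearHash g
    module H = LinearHash h
  field
    a≢ : G.a ≢ H.a
    b≢ : G.b ≢ H.b
    p≢ : G.p ≢ H.p
    -- Inequality as functions of x.  This is implied by inequality at every
    -- x, hence is the weaker of the two possible requirements.
    not-multiple : ∀ k → 0 < k →
      ¬ (∀ (x : Bits n) → G.a * value x + G.b ≡ k * (H.a * value x + H.b))

PairwiseIndependent : ∀ {n} {I : Set} → (I → LinearHash n) → Set
PairwiseIndependent h = ∀ i j → i ≢ j → Independent (h i) (h j)

------------------------------------------------------------------------
-- The class T

D : Vec (Vec ℤ 2) 8
D = ( 1ℤ ∷  0ℤ ∷ [])
  ∷ (-1ℤ ∷  0ℤ ∷ [])
  ∷ ( 0ℤ ∷ -1ℤ ∷ [])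
  ∷ ( 0ℤ ∷  1ℤ ∷ [])
  ∷ (-1ℤ ∷ -1ℤ ∷ [])
  ∷ (-1ℤ ∷  1ℤ ∷ [])
  ∷ ( 1ℤ ∷ -1ℤ ∷ [])
  ∷ ( 1ℤ ∷  1ℤ ∷ [])
  ∷ []

-- All possible outcomes of the random choices.
record Construction (n : ℕ) .{{_ : NonZero n}} : Set where
  field
    M          : Fin n → Fin n → Fin n → Bool
    M-distinct : ∀ i j → i ≢ j → ¬ (∀ r c → M i r c ≡ M j r c)

    row      : Fin n → LinearHash n
    Row      : UniversalFamily (Bits n) n
    row∈Row  : ∀ i → hash (row i) n ∈ᶠ Row
    row-ind  : PairwiseIndependent row

    col      : Fin n → LinearHash n
    Col      : UniversalFamily (Bits n) n
    col∈Col  : ∀ i → hash (col i) n ∈ᶠ Col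
    col-ind  : PairwiseIndependent col

    hd       : Fin n × Fin n → LinearHash n
    Hd       : UniversalFamily (Bits n) 8
    hd∈Hd    : ∀ ij → hash (hd ij) 8 ∈ᶠ Hd
    hd-ind   : PairwiseIndependent hd

-- wrap n z is the position of the 1-based coordinate z, where z < 1 is
-- replaced by n and z > n by 1.
wrap : ∀ n .{{_ : NonZero n}} → ℤ → Fin n
wrap (suc m) (+ suc k) with k <? suc m
... | yes k<n = fromℕ< k<n
... | no  _   = zero
wrap (suc m) (+ zero)  = fromℕ m
wrap (suc m) -[1+ _ ]  = fromℕ m

move : ∀ {n} .{{_ : NonZero n}} → Fin n → ℤ → Fin n
move {n} r δ = wrap n (+ suc (toℕ r) ℤ.+ δ)

module _ {n : ℕ} .{{_ : NonZero n}} (κ : Construction n) where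
  open Construction κ

  step : Bits n → Fin n → Fin n × Fin n → Fin n → Fin n × Fin n
  step x i (r , c) j = move r (lookup δ zero) , move c (lookup δ (suc zero))
    where δ = lookup D (hash (hd (i , j)) 8 x)

  walk : Bits n → Fin n → Fin n × Fin n
  walk x i = foldl (step x i) (hash (row i) n x , hash (col i) n x) (allFin n)

  ⟦_⟧ : Bits n → Bits n
  ⟦_⟧ x = tabulate λ i → M i (proj₁ (walk x i)) (proj₂ (walk x i))

T : ∀ n .{{_ : NonZero n}} → Pred (Bits n → Bits n) 0ℓ
T n τ = Σ (Construction n) λ κ → τ ≗ ⟦ κ ⟧

------------------------------------------------------------------------
-- A register machine with logarithmic costs

-- Programs over finitely many integer registers, read-only arrays (Array k
-- is the set of names of k-dimensional arrays) and an append-only output.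

bitLength : ℤ → ℕ
bitLength z = suc ⌊log₂ ∣ z ∣ ⌋

rem : ℤ → ℤ → ℤ
rem y z with ∣ z ∣
... | zero  = 0ℤ
... | suc m = + (y %ℕ suc m)

module Machine (registers : ℕ) (Array : ℕ → Set) where

  Reg : Set
  Reg = Fin registers

  infix  9 _[_]
  infixl 7 _⊗_ _mod′_
  infixl 6 _⊕_
  infix  4 _≔_
  infix  4 if_less_then_else_
  infixr 3 _⨾_

  data Expr : Set where
    lit               : ℤ → Expr
    reg               : Reg → Expr
    _[_]              : ∀ {k} → Array k → Vec Expr k → Expr
    _⊕_ _⊗_ _mod′_    : Expr → Expr → Expr

  data Cmd : Set where
    skip               : Cmd
    _≔_                : Reg → Expr → Cmd
    append             : Expr → Cmd
    _⨾_                : Cmd → Cmd → Cmd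
    if_less_then_else_ : Expr → Expr → Cmd → Cmd → Cmd
    -- for v e c runs c with v = 1, 2, …, e, where e is evaluated once
    for                : Reg → Expr → Cmd → Cmd

  Arrays : Set
  Arrays = ∀ {k} → Array k → Vec ℤ k → ℤ

  record State : Set where
    constructor ⟨_,_⟩
    field
      store  : Vec ℤ registers
      output : List ℤ

  open State public

  set : Reg → ℤ → State → State
  set v z s = ⟨ store s [ v ]≔ z , output s ⟩

  emit : ℤ → State → State
  emit z s = ⟨ store s , output s ++ (z ∷ []) ⟩

  iterations : ℤ → ℕ
  iterations (+ k)    = k
  iterations -[1+ _ ] = 0

  module _ (mem : Arrays) where

    mutual
      eval : Expr → State → ℤ
      eval (lit z)    s = z
      eval (reg v)    s = lookup (store s) v
      eval (m [ es ]) s = mem m (evals es s)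
      eval (e ⊕ f)    s = eval e s ℤ.+ eval f s
      eval (e ⊗ f)    s = eval e s ℤ.* eval f s
      eval (e mod′ f) s = rem (eval e s) (eval f s)

      evals : ∀ {k} → Vec Expr k → State → Vec ℤ k
      evals []       s = []
      evals (e ∷ es) s = eval e s ∷ evals es s

    -- Addition is charged the total bit length of its operands;
    -- multiplication and remainder are charged as in the schoolbook methods;
    -- an array access is charged for its indices and for the entry read.
    mutual
      cost : Expr → State → ℕ
      cost (lit z)    s = bitLength z
      cost (reg v)    s = bitLength (lookup (store s) v)
      cost (m [ es ]) s = costs es s + bitLength (eval (m [ es ]) s)
      cost (e ⊕ f)    s = cost e s + cost f s
                        + (bitLength (eval e s) + bitLength (eval f s))
      cost (e ⊗ f)    s = cost e s + cost f s
                        + bitLength (eval e s) * bitLength (eval f s)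
      cost (e mod′ f) s = cost e s + cost f s
                        + bitLength (eval e s) * bitLength (eval f s)

      costs : ∀ {k} → Vec Expr k → State → ℕ
      costs []       s = 0
      costs (e ∷ es) s = cost e s + bitLength (eval e s) + costs es s

    mutual
      exec : Cmd → State → State
      exec skip       s = s
      exec (v ≔ e)    s = set v (eval e s) s
      exec (append e) s = emit (eval e s) s
      exec (c ⨾ d)    s = exec d (exec c s)
      exec (if e less f then c else d) s =
        if does (eval e s ℤ.<? eval f s) then exec c s else exec d s
      exec (for v e c) s = execFor v c (iterations (eval e s)) s

      execFor : Reg → Cmd → ℕ → State → State
      execFor v c zero    s = s
      execFor v c (suc k) s = exec c (set v (+ suc k) (execFor v c k s))

    mutual
      time : Cmd → State → ℕ
      time skip       s = 1
      time (v ≔ e)    s = cost e s + bitLength (eval e s)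
      time (append e) s = cost e s + bitLength (eval e s)
      time (c ⨾ d)    s = time c s + time d (exec c s)
      time (if e less f then c else d) s =
        cost e s + cost f s + (bitLength (eval e s) + bitLength (eval f s))
        + (if does (eval e s ℤ.<? eval f s) then time c s else time d s)
      time (for v e c) s =
        cost e s + timeFor v c (bitLength (eval e s)) (iterations (eval e s)) s

      -- Each iteration is charged ℓ, the bit length of the bound, for the
      -- comparison of the counter with the bound, and the bit length of the
      -- counter for its update; the last comparison leaves the loop.
      timeFor : Reg → Cmd → ℕ → ℕ → State → ℕ
      timeFor v c ℓ zero    s = ℓ
      timeFor v c ℓ (suc k) s =
        timeFor v c ℓ k s + (ℓ + bitLength (+ suc k))
        + time c (set v (+ suc k) (execFor v c k s))

------------------------------------------------------------------------
-- The algorithm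

data Array : ℕ → Set where
  arrX                    : Array 1
  arrM                    : Array 3
  rowA rowB rowP          : Array 1
  colA colB colP          : Array 1
  hdA hdB hdP             : Array 2
  arrD                    : Array 2

open Machine 8 Array public

rn rx ri rj rk rr rc rd : Reg
rn = # 0
rx = # 1
ri = # 2
rj = # 3
rk = # 4
rr = # 5
rc = # 6
rd = # 7

hashExpr : ∀ {k} → (a b p : Array k) → Vec Expr k → Expr → Expr
hashExpr a b p es t = (a [ es ] ⊗ reg rx ⊕ b [ es ]) mod′ p [ es ] mod′ t

wrapCmd : Reg → Cmd
wrapCmd v = if reg v less lit 1ℤ then v ≔ reg rn
            else (if reg rn less reg v then v ≔ lit 1ℤ else skip)

-- The first loop computes the integer denoted by the bit sequence x, which
-- is the argument of all the hash functions.
program : Cmd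
program =
  rx ≔ lit 0ℤ ⨾
  for rk (reg rn) (rx ≔ lit (+ 2) ⊗ reg rx ⊕ arrX [ reg rk ∷ [] ]) ⨾
  for ri (reg rn)
    ( rr ≔ hashExpr rowA rowB rowP (reg ri ∷ []) (reg rn) ⊕ lit 1ℤ
    ⨾ rc ≔ hashExpr colA colB colP (reg ri ∷ []) (reg rn) ⊕ lit 1ℤ
    ⨾ for rj (reg rn)
        ( rd ≔ hashExpr hdA hdB hdP (reg ri ∷ reg rj ∷ []) (lit (+ 8)) ⊕ lit 1ℤ
        ⨾ rr ≔ reg rr ⊕ arrD [ reg rd ∷ lit 1ℤ ∷ [] ]
        ⨾ rc ≔ reg rc ⊕ arrD [ reg rd ∷ lit (+ 2) ∷ [] ]
        ⨾ wrapCmd rr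
        ⨾ wrapCmd rc
        )
    ⨾ append (arrM [ reg ri ∷ reg rr ∷ reg rc ∷ [] ])
    )

-- Entry of a 1-based array, and 0 outside its range.
at : ∀ {n} → (Fin n → ℤ) → ℤ → ℤ
at {n} f (+ suc k) with k <? n
... | yes k<n = f (fromℕ< k<n)
... | no  _   = 0ℤ
at f (+ zero)  = 0ℤ
at f -[1+ _ ]  = 0ℤ

module _ {n : ℕ} .{{_ : NonZero n}} (κ : Construction n) where
  open Construction κ
  open LinearHash using (a; b; p)

  arrays : Bits n → Arrays
  arrays x arrX (k ∷ [])         = at (λ k → + bit (lookup x k)) k
  arrays x arrM (i ∷ r ∷ c ∷ []) =
    at (λ i → at (λ r → at (λ c → + bit (M i r c)) c) r) i
  arrays x rowA (i ∷ [])         = at (λ i → + a (row i)) i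
  arrays x rowB (i ∷ [])         = at (λ i → + b (row i)) i
  arrays x rowP (i ∷ [])         = at (λ i → + p (row i)) i
  arrays x colA (i ∷ [])         = at (λ i → + a (col i)) i
  arrays x colB (i ∷ [])         = at (λ i → + b (col i)) i
  arrays x colP (i ∷ [])         = at (λ i → + p (col i)) i
  arrays x hdA (i ∷ j ∷ [])      = at (λ i → at (λ j → + a (hd (i , j))) j) i
  arrays x hdB (i ∷ j ∷ [])      = at (λ i → at (λ j → + b (hd (i , j))) j) i
  arrays x hdP (i ∷ j ∷ [])      = at (λ i → at (λ j → + p (hd (i , j))) j) i
  arrays x arrD (d ∷ l ∷ [])     = at (λ d → at (lookup (lookup D d)) l) d

record Algorithm (n : ℕ) : Set where
  field
    code    : Cmd
    memory  : Bits n → Arrays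
    initial : State

  run : Bits n → State
  run x = exec (memory x) code initial

  runningTime : Bits n → ℕ
  runningTime x = time (memory x) code initial

-- The program text does not depend on n or on τ: the data defining τ are
-- held in its read-only arrays.
A : ∀ {n} .{{_ : NonZero n}} → Construction n → Algorithm n
A {n} κ = record
  { code    = program
  ; memory  = arrays κ
  ; initial = ⟨ replicate 8 0ℤ [ rn ]≔ + n , [] ⟩
  }

record _Computes_Within_ {n} (𝒜 : Algorithm n) (τ : Bits n → Bits n)
                         (bound : ℕ) : Set where
  open Algorithm 𝒜
  field
    correct : ∀ x → output (run x) ≡ List.map (λ y → + bit y) (toList (τ x))
    fast    : ∀ x → runningTime x ≤ bound

-- A polynomial with coefficients in ℕ, constant term first.
Polynomial : Set
Polynomial = List ℕ

evalPoly : Polynomial → ℕ → ℕ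
evalPoly []       n = 0
evalPoly (q ∷ qs) n = q + n * evalPoly qs n

{-# OPTIONS --safe #-}

-- The store of the program only ever holds integers of absolute value at most
-- 2 ^ (n + 3), and so do the arrays.  Hence the sizes of all the values, the
-- costs of all the expressions and the running times of all the commands are
-- bounded by polynomials that are read off the program text, a loop being
-- charged n times the bound of its body.  That the registers stay small is
-- part of the loop invariants, which also say what the registers contain.
module Submission where

open import Defs
open import Data.Bool using (true; false)
open import Data.Fin using (Fin; zero; suc; toℕ; fromℕ<)
open import Data.Fin.Properties
  using (toℕ<n; fromℕ<-toℕ; toℕ-fromℕ<; toℕ-fromℕ; all?)
open import Data.Integer using (ℤ; +_; -[1+_]; 0ℤ; 1ℤ; ∣_∣; +<+; -<+)
import Data.Integer as ℤ
import Data.Integer.DivMod as ℤ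
import Data.Integer.Properties as ℤ
open import Data.List using (List; []; _∷_; allFin; foldl; take)
import Data.List as List
open import Data.List.Properties
  using (foldl-∷ʳ; foldl-map; take-all; take-suc-tabulate; length-tabulate; map-tabulate)
open import Data.Nat
  using (ℕ; zero; suc; _+_; _*_; _^_; _≤_; _<_; _<?_; _≤?_; z≤n; s≤s; NonZero)
open import Data.Nat.DivMod using (_%_; m%n<n)
open import Data.Nat.Logarithm using (⌊log₂_⌋; ⌊log₂⌋-mono-≤; ⌊log₂[2^n]⌋≡n)
open import Data.Nat.Primality using (prime⇒nonZero)
open import Data.Nat.Properties
open import Data.Nat.Tactic.RingSolver using (solve-∀)
open import Data.Product using (Σ; ∃-syntax; _×_; _,_; proj₁; proj₂)
open import Data.Vec using (Vec; []; _∷_; lookup; toList; _[_]≔_)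
import Data.Vec as Vec
open import Data.Vec.Properties using ([]≔-lookup; tabulate∘lookup)
open import Data.Vec.Relation.Unary.All using (All; []; _∷_)
open import Data.Vec.Relation.Unary.All.Properties using (lookup⁺)
open import Function using (_∘_)
open import Relation.Binary.PropositionalEquality hiding ([_])
open import Relation.Nullary using (¬_; yes; no; contradiction; from-yes)
open import Relation.Unary using (_∈_)

-- Polynomials

constₚ : ℕ → Polynomial
constₚ c = c ∷ []

varₚ : Polynomial
varₚ = 0 ∷ 1 ∷ []

infixl 6 _+ₚ_
infixl 7 _*ₚ_

_+ₚ_ : Polynomial → Polynomial → Polynomial
[]      +ₚ q       = q
(a ∷ p) +ₚ []      = a ∷ p
(a ∷ p) +ₚ (b ∷ q) = a + b ∷ p +ₚ q

scale : ℕ → Polynomial → Polynomial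
scale a = List.map (a *_)

_*ₚ_ : Polynomial → Polynomial → Polynomial
[]      *ₚ q = []
(a ∷ p) *ₚ q = scale a q +ₚ (0 ∷ p *ₚ q)

evalPoly-+ : ∀ p q n → evalPoly (p +ₚ q) n ≡ evalPoly p n + evalPoly q n
evalPoly-+ []      q       n = refl
evalPoly-+ (a ∷ p) []      n = sym (+-identityʳ _)
evalPoly-+ (a ∷ p) (b ∷ q) n rewrite evalPoly-+ p q n =
  rearrange a b n (evalPoly p n) (evalPoly q n)
  where
  rearrange : ∀ a b n x y → a + b + n * (x + y) ≡ a + n * x + (b + n * y)
  rearrange = solve-∀

evalPoly-scale : ∀ a p n → evalPoly (scale a p) n ≡ a * evalPoly p n
evalPoly-scale a []      n = sym (*-zeroʳ a)
evalPoly-scale a (b ∷ p) n rewrite evalPoly-scale a p n =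
  rearrange a b n (evalPoly p n)
  where
  rearrange : ∀ a b n x → a * b + n * (a * x) ≡ a * (b + n * x)
  rearrange = solve-∀

evalPoly-* : ∀ p q n → evalPoly (p *ₚ q) n ≡ evalPoly p n * evalPoly q n
evalPoly-* []      q n = refl
evalPoly-* (a ∷ p) q n
  rewrite evalPoly-+ (scale a q) (0 ∷ p *ₚ q) n
        | evalPoly-scale a q n | evalPoly-* p q n =
  rearrange a n (evalPoly p n) (evalPoly q n)
  where
  rearrange : ∀ a n x y → a * y + n * (x * y) ≡ (a + n * x) * y
  rearrange = solve-∀

infix 4 _≤[_]_

-- A record rather than a synonym, so that p can be inferred.
record _≤[_]_ (a n : ℕ) (p : Polynomial) : Set where
  constructor bounded
  field bound : a ≤ evalPoly p n

open _≤[_]_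

module _ {n : ℕ} where

  ≤-const : ∀ {a c} → a ≤ c → a ≤[ n ] constₚ c
  ≤-const {c = c} a≤c .bound = ≤-trans a≤c (m≤m+n c _)

  ≤-var : ∀ {a} → a ≤ n → a ≤[ n ] varₚ
  ≤-var a≤n .bound rewrite *-zeroʳ n | *-identityʳ n = a≤n

  ≤-+ : ∀ {a b p q} → a ≤[ n ] p → b ≤[ n ] q → a + b ≤[ n ] (p +ₚ q)
  ≤-+ {p = p} {q} (bounded a≤) (bounded b≤) .bound
    rewrite evalPoly-+ p q n = +-mono-≤ a≤ b≤

  ≤-* : ∀ {a b p q} → a ≤[ n ] p → b ≤[ n ] q → a * b ≤[ n ] (p *ₚ q)
  ≤-* {p = p} {q} (bounded a≤) (bounded b≤) .bound
    rewrite evalPoly-* p q n = *-mono-≤ a≤ b≤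

  ≤-+ʳ : ∀ {a p q} → a ≤[ n ] p → a ≤[ n ] (p +ₚ q)
  ≤-+ʳ {p = p} {q} (bounded a≤) .bound rewrite evalPoly-+ p q n =
    ≤-trans a≤ (m≤m+n _ _)

  ≤-+ˡ : ∀ {a p q} → a ≤[ n ] q → a ≤[ n ] (p +ₚ q)
  ≤-+ˡ {p = p} {q} (bounded a≤) .bound rewrite evalPoly-+ p q n =
    ≤-trans a≤ (m≤n+m _ _)

-- Powers of two and bit lengths

n<2^n : ∀ n → n < 2 ^ n
n<2^n zero    = s≤s z≤n
n<2^n (suc n) = begin-strict
  suc n          ≤⟨ n<2^n n ⟩
  2 ^ n          <⟨ m<m+n (2 ^ n) (m^n>0 2 n) ⟩
  2 ^ n + 2 ^ n  ≡⟨ cong (_+_ (2 ^ n)) (+-identityʳ (2 ^ n)) ⟨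
  2 ^ suc n      ∎
  where open ≤-Reasoning

bitLength-≤ : ∀ {z w} → ∣ z ∣ ≤ 2 ^ w → bitLength z ≤ 1 + w
bitLength-≤ {z} {w} z≤ =
  s≤s (subst (⌊log₂ ∣ z ∣ ⌋ ≤_) (⌊log₂[2^n]⌋≡n w) (⌊log₂⌋-mono-≤ z≤))

-- Both powers are at most 2 ^ (v + w), and doubling gives the 1. The exponents are added instead of
-- taking their maximum, because polynomials are closed under sums.
∣+∣≤2^ : ∀ y z v w → ∣ y ∣ ≤ 2 ^ v → ∣ z ∣ ≤ 2 ^ w →
         ∣ y ℤ.+ z ∣ ≤ 2 ^ (1 + (v + w))
∣+∣≤2^ y z v w y≤ z≤ = begin
  ∣ y ℤ.+ z ∣                ≤⟨ ℤ.∣i+j∣≤∣i∣+∣j∣ y z ⟩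
  ∣ y ∣ + ∣ z ∣              ≤⟨ +-mono-≤ y≤ z≤ ⟩
  2 ^ v + 2 ^ w              ≤⟨ +-mono-≤ (^-monoʳ-≤ 2 (m≤m+n v w))
                                         (^-monoʳ-≤ 2 (m≤n+m w v)) ⟩
  2 ^ (v + w) + 2 ^ (v + w)  ≡⟨ cong (_+_ (2 ^ (v + w))) (+-identityʳ _) ⟨
  2 ^ (1 + (v + w))          ∎
  where open ≤-Reasoning

∣*∣≤2^ : ∀ y z v w → ∣ y ∣ ≤ 2 ^ v → ∣ z ∣ ≤ 2 ^ w →
         ∣ y ℤ.* z ∣ ≤ 2 ^ (v + w)
∣*∣≤2^ y z v w y≤ z≤
  rewrite ℤ.abs-* y z | ^-distribˡ-+-* 2 v w = *-mono-≤ y≤ z≤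

-- A remainder is below its modulus, and is 0 for modulus 0. Hence a reduction resets the size of a
-- value, however large the dividend was.
∣rem∣≤ : ∀ y z → ∣ rem y z ∣ ≤ ∣ z ∣
∣rem∣≤ y z with ∣ z ∣
... | zero  = z≤n
... | suc m = <⇒≤ (ℤ.n%ℕd<d y (suc m))

rem-+ : ∀ m d .{{_ : NonZero d}} → rem (+ m) (+ d) ≡ + (m % d)
rem-+ m (suc d) = refl

-- Reading the arrays

at-toℕ : ∀ {n} (f : Fin n → ℤ) i → at f (+ suc (toℕ i)) ≡ f i
at-toℕ {n} f i with toℕ i <? n
... | yes i<n = cong f (fromℕ<-toℕ i i<n)
... | no  i≮n = contradiction (toℕ<n i) i≮n

-- The default value 0 obeys every bound, so the size of an entry is controlled at every integer
-- index, in range or not.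
∣at∣≤ : ∀ {n b} {f : Fin n → ℤ} → (∀ i → ∣ f i ∣ ≤ b) → ∀ z → ∣ at f z ∣ ≤ b
∣at∣≤ {n} f≤ (+ suc k) with k <? n
... | yes k<n = f≤ (fromℕ< k<n)
... | no  _   = z≤n
∣at∣≤ f≤ (+ zero)  = z≤n
∣at∣≤ f≤ -[1+ _ ]  = z≤n

bit≤1 : ∀ b → bit b ≤ 1
bit≤1 false = z≤n
bit≤1 true  = s≤s z≤n

∣D∣≤1 : ∀ d l → ∣ lookup (lookup D d) l ∣ ≤ 1
∣D∣≤1 = from-yes (all? λ d → all? λ l → ∣ lookup (lookup D d) l ∣ ≤? 1)

module _ {n : ℕ} .{{_ : NonZero n}} (κ : Construction n) where
  open Construction κ
  open LinearHash

  -- The hash parameters satisfy a, b < p < 2 ^ n because p has n bits; all other entries have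
  -- absolute value at most 1.
  ∣arrays∣≤2^n : ∀ x {k} (m : Array k) is → ∣ arrays κ x m is ∣ ≤ 2 ^ n
  ∣arrays∣≤2^n x = go
    where
    a≤ : ∀ h → a h ≤ 2 ^ n
    a≤ h = <⇒≤ (<-trans (a<p h) (proj₂ (n-bit h)))

    b≤ : ∀ h → b h ≤ 2 ^ n
    b≤ h = <⇒≤ (<-trans (b<p h) (proj₂ (n-bit h)))

    p≤ : ∀ h → p h ≤ 2 ^ n
    p≤ h = <⇒≤ (proj₂ (n-bit h))

    1≤2^n : 1 ≤ 2 ^ n
    1≤2^n = m^n>0 2 n

    go : ∀ {k} (m : Array k) is → ∣ arrays κ x m is ∣ ≤ 2 ^ n
    go arrX (k ∷ [])         = ∣at∣≤ (λ k → ≤-trans (bit≤1 (lookup x k)) 1≤2^n) k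
    go arrM (i ∷ r ∷ c ∷ []) =
      ∣at∣≤ (λ i → ∣at∣≤ (λ r → ∣at∣≤ (λ c → ≤-trans (bit≤1 (M i r c)) 1≤2^n) c) r) i
    go rowA (i ∷ [])         = ∣at∣≤ (λ i → a≤ (row i)) i
    go rowB (i ∷ [])         = ∣at∣≤ (λ i → b≤ (row i)) i
    go rowP (i ∷ [])         = ∣at∣≤ (λ i → p≤ (row i)) i
    go colA (i ∷ [])         = ∣at∣≤ (λ i → a≤ (col i)) i
    go colB (i ∷ [])         = ∣at∣≤ (λ i → b≤ (col i)) i
    go colP (i ∷ [])         = ∣at∣≤ (λ i → p≤ (col i)) i
    go hdA (i ∷ j ∷ [])      = ∣at∣≤ (λ i → ∣at∣≤ (λ j → a≤ (hd (i , j))) j) i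
    go hdB (i ∷ j ∷ [])      = ∣at∣≤ (λ i → ∣at∣≤ (λ j → b≤ (hd (i , j))) j) i
    go hdP (i ∷ j ∷ [])      = ∣at∣≤ (λ i → ∣at∣≤ (λ j → p≤ (hd (i , j))) j) i
    go arrD (d ∷ l ∷ [])     =
      ∣at∣≤ (λ d → ∣at∣≤ (λ l → ≤-trans (∣D∣≤1 d l) 1≤2^n) l) d

-- Polynomial bounds read off the program text

-- The polynomial 3 + n. Partial values of `x` need n bits; the extra factor 8 makes room for the
-- directions 1, ..., 8 and for coordinates up to n + 1.
registerWidth : Polynomial
registerWidth = 3 ∷ 1 ∷ []

-- The value of e has absolute value at most 2 to the power of width e.
width : Expr → Polynomial
width (lit z)    = constₚ ∣ z ∣
width (reg v)    = registerWidth
width (m [ es ]) = registerWidth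
width (e ⊕ f)    = constₚ 1 +ₚ (width e +ₚ width f)
width (e ⊗ f)    = width e +ₚ width f
width (e mod′ f) = width f

lengthₚ : Expr → Polynomial
lengthₚ e = constₚ 1 +ₚ width e

mutual
  costₚ : Expr → Polynomial
  costₚ (lit z)    = lengthₚ (lit z)
  costₚ (reg v)    = lengthₚ (reg v)
  costₚ (m [ es ]) = costsₚ es +ₚ lengthₚ (m [ es ])
  costₚ (e ⊕ f)    = costₚ e +ₚ costₚ f +ₚ (lengthₚ e +ₚ lengthₚ f)
  costₚ (e ⊗ f)    = costₚ e +ₚ costₚ f +ₚ lengthₚ e *ₚ lengthₚ f
  costₚ (e mod′ f) = costₚ e +ₚ costₚ f +ₚ lengthₚ e *ₚ lengthₚ f

  costsₚ : ∀ {k} → Vec Expr k → Polynomial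
  costsₚ []       = constₚ 0
  costsₚ (e ∷ es) = costₚ e +ₚ lengthₚ e +ₚ costsₚ es

timeₚ : Cmd → Polynomial
timeₚ skip       = constₚ 1
timeₚ (v ≔ e)    = costₚ e +ₚ lengthₚ e
timeₚ (append e) = costₚ e +ₚ lengthₚ e
timeₚ (c ⨾ d)    = timeₚ c +ₚ timeₚ d
-- Both branches are charged, so that the bound does not depend on the guard.
timeₚ (if e less f then c else d) =
  costₚ e +ₚ costₚ f +ₚ (lengthₚ e +ₚ lengthₚ f) +ₚ (timeₚ c +ₚ timeₚ d)
timeₚ (for v e c) =
  -- The first `lengthₚ e` pays for the comparison that leaves the loop. The factor `varₚ` presumes
  -- that the loop bound evaluates to n, which `wp-for` demands.
  costₚ e +ₚ (lengthₚ e +ₚ varₚ *ₚ (lengthₚ e +ₚ lengthₚ (reg v) +ₚ timeₚ c))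

-- Weakest preconditions

module WeakestPreconditions (n : ℕ) (mem : Arrays)
  (mem≤ : ∀ {k} (m : Array k) is → ∣ mem m is ∣ ≤ 2 ^ n) where

  w : ℕ
  w = evalPoly registerWidth n

  2^[3+n]≤2^w : 2 ^ (3 + n) ≤ 2 ^ w
  2^[3+n]≤2^w = ^-monoʳ-≤ 2 (+-monoʳ-≤ 3 (≤-var {n} ≤-refl .bound))

  2^n≤2^w : 2 ^ n ≤ 2 ^ w
  2^n≤2^w = ≤-trans (^-monoʳ-≤ 2 (m≤n+m n 3)) 2^[3+n]≤2^w

  -- 8 + n = 7 + (n + 1) is at most 7 * 2 ^ n + 2 ^ n. This serves the counters, coordinates and
  -- directions, whereas partial values of `x` are compared with 2 ^ n.
  ≤8+n⇒≤2^w : ∀ {m} → m ≤ 8 + n → m ≤ 2 ^ w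
  ≤8+n⇒≤2^w {m} m≤ = begin
    m                    ≤⟨ m≤ ⟩
    8 + n                ≡⟨ +-suc 7 n ⟨
    7 * 1 + suc n        ≤⟨ +-mono-≤ (*-monoʳ-≤ 7 (m^n>0 2 n)) (n<2^n n) ⟩
    7 * 2 ^ n + 2 ^ n    ≡⟨ eight (2 ^ n) ⟩
    2 ^ (3 + n)          ≤⟨ 2^[3+n]≤2^w ⟩
    2 ^ w                ∎
    where
    open ≤-Reasoning
    eight : ∀ t → 7 * t + t ≡ 2 * (2 * (2 * t))
    eight = solve-∀

  Small : State → Set
  Small s = All (λ z → ∣ z ∣ ≤ 2 ^ w) (store s)

  module _ (s : State) (small : Small s) where

    lookup-≤ : ∀ v → ∣ lookup (store s) v ∣ ≤ 2 ^ w
    lookup-≤ v = lookup⁺ small v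

    eval-≤ : ∀ e → ∣ eval mem e s ∣ ≤ 2 ^ evalPoly (width e) n
    -- Literals are constants of the program text, so the crude exponent ∣ z ∣ still gives a
    -- constant polynomial.
    eval-≤ (lit z) =
      ≤-trans (<⇒≤ (n<2^n ∣ z ∣)) (^-monoʳ-≤ 2 (m≤m+n ∣ z ∣ _))
    eval-≤ (reg v)    = lookup-≤ v
    eval-≤ (m [ es ]) = ≤-trans (mem≤ m _) 2^n≤2^w
    eval-≤ (e ⊕ f)    =
      ≤-trans (∣+∣≤2^ (eval mem e s) (eval mem f s) (evalPoly (width e) n) (evalPoly (width f) n)
                      (eval-≤ e) (eval-≤ f))
              (^-monoʳ-≤ 2 (≤-+ (≤-const {a = 1} ≤-refl)
                (≤-+ (bounded {p = width e} ≤-refl)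
                     (bounded {p = width f} ≤-refl)) .bound))
    eval-≤ (e ⊗ f)    =
      ≤-trans (∣*∣≤2^ (eval mem e s) (eval mem f s) (evalPoly (width e) n) (evalPoly (width f) n)
                      (eval-≤ e) (eval-≤ f))
              (^-monoʳ-≤ 2 (≤-+ (bounded {p = width e} ≤-refl)
                                (bounded {p = width f} ≤-refl) .bound))
    eval-≤ (e mod′ f) =
      ≤-trans (∣rem∣≤ (eval mem e s) (eval mem f s)) (eval-≤ f)

    length-≤ : ∀ e → bitLength (eval mem e s) ≤[ n ] lengthₚ e
    length-≤ e .bound =
      ≤-trans (bitLength-≤ {eval mem e s} (eval-≤ e))
              (≤-+ (≤-const {a = 1} ≤-refl) (bounded {p = width e} ≤-refl) .bound)

    mutual
      cost-≤ : ∀ e → cost mem e s ≤[ n ] costₚ e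
      cost-≤ (lit z)    = length-≤ (lit z)
      cost-≤ (reg v)    = length-≤ (reg v)
      cost-≤ (m [ es ]) = ≤-+ (costs-≤ es) (length-≤ (m [ es ]))
      cost-≤ (e ⊕ f)    =
        ≤-+ (≤-+ (cost-≤ e) (cost-≤ f)) (≤-+ (length-≤ e) (length-≤ f))
      cost-≤ (e ⊗ f)    =
        ≤-+ (≤-+ (cost-≤ e) (cost-≤ f)) (≤-* (length-≤ e) (length-≤ f))
      cost-≤ (e mod′ f) =
        ≤-+ (≤-+ (cost-≤ e) (cost-≤ f)) (≤-* (length-≤ e) (length-≤ f))

      costs-≤ : ∀ {k} (es : Vec Expr k) → costs mem es s ≤[ n ] costsₚ es
      costs-≤ []       = ≤-const z≤n
      costs-≤ (e ∷ es) = ≤-+ (≤-+ (cost-≤ e) (length-≤ e)) (costs-≤ es)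

  small-set : ∀ {s} v {z} → Small s → ∣ z ∣ ≤ 2 ^ w → Small (set v z s)
  small-set v {z} small z≤ = go v small
    where
    go : ∀ {k} {zs : Vec ℤ k} v → All (λ y → ∣ y ∣ ≤ 2 ^ w) zs →
         All (λ y → ∣ y ∣ ≤ 2 ^ w) (zs [ v ]≔ z)
    go zero    (_  ∷ zs≤) = z≤ ∷ zs≤
    go (suc v) (y≤ ∷ zs≤) = y≤ ∷ go v zs≤

  -- Postcondition, smallness and time are proved together: time bounds rest on smallness of the
  -- current state, which in turn comes from what the invariants say about the registers. A record
  -- keeps `c`, `Q` and `s` visible to unification.
  record WP (c : Cmd) (Q : State → Set) (s : State) : Set where
    constructor wp
    field
      run : Small s →
            Q (exec mem c s) × Small (exec mem c s) × (time mem c s ≤[ n ] timeₚ c)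

  open WP public

  wp-skip : ∀ {Q s} → Q s → WP skip Q s
  wp-skip q .run small = q , small , ≤-const ≤-refl

  -- The size of the new value is a hypothesis because `width e` may exceed the register width;
  -- relying on it alone would let the bound grow with every round of a loop.
  wp-assign : ∀ {v e Q s} z → eval mem e s ≡ z → ∣ z ∣ ≤ 2 ^ w →
              Q (set v z s) → WP (v ≔ e) Q s
  wp-assign {v} {e} {s = s} z refl z≤ q .run small =
    q , small-set {s} v small z≤ , ≤-+ (cost-≤ s small e) (length-≤ s small e)

  wp-append : ∀ {e Q s} z → eval mem e s ≡ z → Q (emit z s) → WP (append e) Q s
  wp-append {e} {s = s} z refl q .run small =
    q , small , ≤-+ (cost-≤ s small e) (length-≤ s small e)

  wp-seq : ∀ {c d Q s} → WP c (WP d Q) s → WP (c ⨾ d) Q s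
  wp-seq wpc .run small =
    let wpd , small₁ , t₁ = wpc .run small
        q   , small₂ , t₂ = wpd .run small₁
    in q , small₂ , ≤-+ t₁ t₂

  wp-if : ∀ {e f c d Q s} →
          (eval mem e s ℤ.< eval mem f s → WP c Q s) →
          (¬ eval mem e s ℤ.< eval mem f s → WP d Q s) →
          WP (if e less f then c else d) Q s
  wp-if {e} {f} {c} {d} {s = s} wpc wpd .run small
    with guard ← ≤-+ (≤-+ (cost-≤ s small e) (cost-≤ s small f))
                     (≤-+ (length-≤ s small e) (length-≤ s small f))
    with eval mem e s ℤ.<? eval mem f s
  ... | yes lt = let q , small′ , t = wpc lt .run small in
    q , small′ , ≤-+ guard (≤-+ʳ t)
  ... | no nlt = let q , small′ , t = wpd nlt .run small in
    q , small′ , ≤-+ guard (≤-+ˡ t)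

  -- The invariant is indexed by the number of completed rounds. A round is given by an element of
  -- `Fin n`, the index type of the data of the construction and of its folds over `allFin n`.
  wp-for : ∀ {v e c Q s} (Inv : ℕ → State → Set) → eval mem e s ≡ + n → Inv 0 s →
           (∀ i {s} → Inv (toℕ {n} i) s →
                      WP c (Inv (suc (toℕ i))) (set v (+ suc (toℕ i)) s)) →
           (∀ {s} → Inv n s → Q s) → WP (for v e c) Q s
  wp-for {v} {e} {c} {s = s} Inv e≡n inv₀ step post .run small
    -- Introduced before the rewrite, which turns `ℓ≤` into a bound on the length of n.
    with guard ← cost-≤ s small e | ℓ≤ ← length-≤ s small e
    rewrite e≡n =
    let inv , small′ , t = go ℓ≤ n ≤-refl
        rounds = ≤-* (≤-var {n} {a = n} ≤-refl) (bounded {p = round} ≤-refl)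
    in post inv , small′ , ≤-+ guard (bounded (≤-trans t (≤-+ ℓ≤ rounds .bound)))
    where
    ℓ : ℕ
    ℓ = bitLength (+ n)

    round : Polynomial
    round = lengthₚ e +ₚ lengthₚ (reg v) +ₚ timeₚ c

    r : ℕ
    r = evalPoly round n

    counter≤ : ∀ {k} → ∣ + k ∣ ≤ 2 ^ w → bitLength (+ k) ≤[ n ] lengthₚ (reg v)
    counter≤ {k} k≤ = bounded (≤-trans (bitLength-≤ {+ k} k≤)
      (≤-+ {n} (≤-const {a = 1} ≤-refl) (bounded {p = registerWidth} ≤-refl) .bound))

    go : ℓ ≤[ n ] lengthₚ e → ∀ k → k ≤ n →
         Inv k (execFor mem v c k s) × Small (execFor mem v c k s) ×
         timeFor mem v c ℓ k s ≤ ℓ + k * r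
    go ℓ≤ zero    _   = inv₀ , small , m≤m+n ℓ 0
    go ℓ≤ (suc k) k<n =
      let inv  , small′ , t  = go ℓ≤ k (<⇒≤ k<n)
          k≤2^w              = ≤8+n⇒≤2^w (≤-trans k<n (m≤n+m n 8))
          inv⁺ , small⁺ , t⁺ = body inv .run (small-set {execFor mem v c k s} v small′ k≤2^w)
      in inv⁺ , small⁺ , add t (≤-+ (≤-+ ℓ≤ (counter≤ k≤2^w)) t⁺ .bound)
      where
      body : ∀ {s} → Inv k s → WP c (Inv (suc k)) (set v (+ suc k) s)
      -- `step` speaks of numbers of the form `toℕ i`; the index k is one of them, with i =
      -- `fromℕ< k<n`.
      body = subst (λ k → ∀ {s} → Inv k s → WP c (Inv (suc k)) (set v (+ suc k) s))
                   (toℕ-fromℕ< k<n) (step (fromℕ< k<n))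

      add : ∀ {t u u′} → t ≤ ℓ + k * r → u + u′ ≤ r → t + u + u′ ≤ ℓ + (r + k * r)
      add {t} {u} {u′} t≤ u≤ = begin
        t + u + u′         ≡⟨ +-assoc t u u′ ⟩
        t + (u + u′)       ≤⟨ +-mono-≤ t≤ u≤ ⟩
        ℓ + k * r + r      ≡⟨ +-assoc ℓ (k * r) r ⟩
        ℓ + (k * r + r)    ≡⟨ cong (_+_ ℓ) (+-comm (k * r) r) ⟩
        ℓ + (r + k * r)    ∎
        where open ≤-Reasoning

-- The algorithm

-- This and the next two lemmas correspond to the three branches of `wrapCmd`, which works with
-- 1-based coordinates.
wrap-below : ∀ n .{{_ : NonZero n}} {z} → z ℤ.< 1ℤ → + suc (toℕ (wrap n z)) ≡ + n
wrap-below (suc m) {+ zero}   _ = cong (+_ ∘ suc) (toℕ-fromℕ m)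
wrap-below (suc m) { -[1+ _ ]} _ = cong (+_ ∘ suc) (toℕ-fromℕ m)
wrap-below (suc m) {+ suc _} (+<+ (s≤s ()))

wrap-above : ∀ n .{{_ : NonZero n}} {z} → + n ℤ.< z → + suc (toℕ (wrap n z)) ≡ 1ℤ
wrap-above (suc m) {+ suc k} (+<+ n<z) with k <? suc m
... | yes k<n = contradiction n<z (≤⇒≯ k<n)
... | no  _   = refl

wrap-inside : ∀ n .{{_ : NonZero n}} {z} → ¬ z ℤ.< 1ℤ → ¬ + n ℤ.< z →
              + suc (toℕ (wrap n z)) ≡ z
wrap-inside (suc m) {+ zero}    z≮1 _   = contradiction (+<+ (s≤s z≤n)) z≮1
wrap-inside (suc m) { -[1+ _ ]} z≮1 _   = contradiction -<+ z≮1
wrap-inside (suc m) {+ suc k}   _   n≮z with k <? suc m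
... | yes k<n = cong (+_ ∘ suc) (toℕ-fromℕ< k<n)
... | no  k≮n = contradiction (+<+ (≰⇒> k≮n)) n≮z

-- `A`, `B` and `P` stand for array entries, so that row, column and direction hashes are treated at
-- once. All operands are nonnegative, hence the integer operations agree with those on ℕ; the final
-- 1 passes to 1-based numbering.
hash-correct : ∀ {n} (h : LinearHash n) t .{{_ : NonZero t}} x {A B P} →
               A ≡ + LinearHash.a h → B ≡ + LinearHash.b h → P ≡ + LinearHash.p h →
               rem (rem (A ℤ.* + value x ℤ.+ B) P) (+ t) ℤ.+ 1ℤ ≡
               + suc (toℕ (hash h t x))
hash-correct h t x refl refl refl = begin
  rem (rem (+ a ℤ.* + v ℤ.+ + b) (+ p)) (+ t) ℤ.+ 1ℤ
    ≡⟨ cong (λ z → rem (rem (z ℤ.+ + b) (+ p)) (+ t) ℤ.+ 1ℤ) (ℤ.pos-* a v) ⟨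
  rem (rem (+ (a * v + b)) (+ p)) (+ t) ℤ.+ 1ℤ
    ≡⟨ cong (λ z → rem z (+ t) ℤ.+ 1ℤ) (rem-+ (a * v + b) p) ⟩
  rem (+ ((a * v + b) % p)) (+ t) ℤ.+ 1ℤ
    ≡⟨ cong (ℤ._+ 1ℤ) (rem-+ ((a * v + b) % p) t) ⟩
  + ((a * v + b) % p % t + 1)
    ≡⟨ cong +_ (+-comm _ 1) ⟩
  + suc ((a * v + b) % p % t)
    ≡⟨ cong (+_ ∘ suc) (toℕ-fromℕ< (m%n<n ((a * v + b) % p) t)) ⟨
  + suc (toℕ (hash h t x)) ∎
  where
  open ≡-Reasoning
  open LinearHash h hiding (hash)
  instance _ = prime⇒nonZero prime
  v = value x

-- The inductive step of the loop invariants: one more round of a loop is one more step of the fold.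
foldl-take-suc : ∀ {A : Set} {n} (f : A → Fin n → A) z i →
                  foldl f z (take (suc (toℕ i)) (allFin n)) ≡
                  f (foldl f z (take (toℕ i) (allFin n))) i
foldl-take-suc {n = n} f z i
  rewrite take-suc-tabulate {n = n} (λ i → i) i =
  foldl-∷ʳ f z i (take (toℕ i) (allFin n))

take-tabulate : ∀ {A : Set} {n} (f : Fin n → A) →
                take n (List.tabulate f) ≡ List.tabulate f
take-tabulate {n = n} f = take-all n _ (≤-reflexive (length-tabulate f))

toList-tabulate : ∀ {A : Set} {n} (f : Fin n → A) →
                  toList (Vec.tabulate f) ≡ List.tabulate f
toList-tabulate {n = zero}  f = refl
toList-tabulate {n = suc n} f = cong (f zero ∷_) (toList-tabulate (f ∘ suc))

-- Reconciles `value`, a fold over the bits themselves, with the reading loop, which runs over their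
-- indices.
foldl-lookup : ∀ {A B : Set} {n} (f : B → A → B) z (xs : Vec A n) →
               foldl (λ y i → f y (lookup xs i)) z (allFin n) ≡ foldl f z (toList xs)
foldl-lookup {n = n} f z xs = begin
  foldl (λ y i → f y (lookup xs i)) z (allFin n)  ≡⟨ foldl-map f (lookup xs) z (allFin n) ⟨
  foldl f z (List.map (lookup xs) (allFin n))     ≡⟨ cong (foldl f z) (map-tabulate (λ i → i) (lookup xs)) ⟩
  foldl f z (List.tabulate (lookup xs))           ≡⟨ cong (foldl f z) (toList-tabulate (lookup xs)) ⟨
  foldl f z (toList (Vec.tabulate (lookup xs)))   ≡⟨ cong (foldl f z ∘ toList) (tabulate∘lookup xs) ⟩
  foldl f z (toList xs)                           ∎
  where open ≡-Reasoning

-- Correctness and running time of the program on a fixed input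

module _ {n : ℕ} .{{_ : NonZero n}} (κ : Construction n) (x : Bits n) where
  open Construction κ
  open WeakestPreconditions n (arrays κ x) (∣arrays∣≤2^n κ x)

  position : Fin n → ℤ
  position r = + suc (toℕ r)

  position≤2^w : ∀ r → ∣ position r ∣ ≤ 2 ^ w
  position≤2^w r = ≤8+n⇒≤2^w (≤-trans (toℕ<n r) (m≤n+m n 8))

  -- For the states between a move and its wrapping, when a coordinate may be out of range by one.
  D≤2^w : ∀ r d l → ∣ position r ℤ.+ lookup (lookup D d) l ∣ ≤ 2 ^ w
  D≤2^w r d l = ≤8+n⇒≤2^w (begin
    ∣ position r ℤ.+ lookup (lookup D d) l ∣
      ≤⟨ ℤ.∣i+j∣≤∣i∣+∣j∣ (position r) (lookup (lookup D d) l) ⟩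
    suc (toℕ r) + ∣ lookup (lookup D d) l ∣   ≤⟨ +-mono-≤ (toℕ<n r) (∣D∣≤1 d l) ⟩
    n + 1                                     ≡⟨ +-comm n 1 ⟩
    1 + n                                     ≤⟨ +-monoˡ-≤ n {1} {8} (s≤s z≤n) ⟩
    8 + n                                     ∎)
    where open ≤-Reasoning

  wp-wrap : ∀ v {Q s} → lookup (store s) rn ≡ + n →
            Q (set v (position (wrap n (lookup (store s) v))) s) → WP (wrapCmd v) Q s
  wp-wrap v {Q} {s} n≡ q = wp-if
    (λ z<1 → wp-assign _ (trans n≡ (sym (wrap-below n z<1))) (position≤2^w _) q)
    (λ z≮1 → wp-if
      (λ n<z → wp-assign _ (sym (wrap-above n (subst (ℤ._< z) n≡ n<z))) (position≤2^w _) q)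
      -- Here the program does nothing, while `q` concerns a store in which `v` is overwritten; the
      -- value written is the one already there.
      (λ n≮z → wp-skip (subst Q (unchanged z≮1 (n≮z ∘ subst (ℤ._< z) (sym n≡))) q)))
    where
    z = lookup (store s) v
    unchanged : ¬ z ℤ.< 1ℤ → ¬ + n ℤ.< z → set v (position (wrap n z)) s ≡ s
    unchanged z≮1 n≮z rewrite wrap-inside n z≮1 n≮z =
      cong ⟨_, output s ⟩ ([]≔-lookup (store s) v)

  -- With `rn` fixed at n, every loop bound and modulus `reg rn` evaluates to n by computation.
  registers : (x i j k r c d : ℤ) → List ℤ → State
  registers x i j k r c d out = ⟨ + n ∷ x ∷ i ∷ j ∷ k ∷ r ∷ c ∷ d ∷ [] , out ⟩

  -- The first loop: reading the input

  push : ℕ → Fin n → ℕ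
  push v k = 2 * v + bit (lookup x k)

  prefixValue : ℕ → ℕ
  prefixValue k = foldl push 0 (take k (allFin n))

  prefixValue-n : prefixValue n ≡ value x
  prefixValue-n = trans (cong (foldl push 0) (take-tabulate (λ i → i)))
                        (foldl-lookup (λ v b → 2 * v + bit b) 0 x)

  -- The bound 2 ^ k is what keeps `rx` small. The counter register is left open, since each round
  -- overwrites it before running the body.
  ReadInv : ℕ → State → Set
  ReadInv k s = ∃[ k′ ] s ≡ registers (+ prefixValue k) 0ℤ 0ℤ k′ 0ℤ 0ℤ 0ℤ []
                        × prefixValue k < 2 ^ k

  read-step : ∀ (k : Fin n) {s} → ReadInv (toℕ k) s →
              WP (rx ≔ lit (+ 2) ⊗ reg rx ⊕ arrX [ reg rk ∷ [] ])
                 (ReadInv (suc (toℕ k))) (set rk (+ suc (toℕ k)) s)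
  read-step k (_ , refl , v<) =
    wp-assign (+ prefixValue (suc (toℕ k))) next
      (≤-trans (<⇒≤ v<′) (≤-trans (^-monoʳ-≤ 2 (toℕ<n k)) 2^n≤2^w))
      (_ , refl , v<′)
    where
    v = prefixValue (toℕ k)

    suc≡ : prefixValue (suc (toℕ k)) ≡ push v k
    suc≡ = foldl-take-suc push 0 k

    next : + 2 ℤ.* + v ℤ.+ at (λ k → + bit (lookup x k)) (+ suc (toℕ k)) ≡
           + prefixValue (suc (toℕ k))
    next rewrite suc≡ | at-toℕ (λ k → + bit (lookup x k)) k =
      cong (ℤ._+ + bit (lookup x k)) (sym (ℤ.pos-* 2 v))

    v<′ : prefixValue (suc (toℕ k)) < 2 ^ suc (toℕ k)
    v<′ rewrite suc≡ = begin-strict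
      2 * v + bit (lookup x k)  ≤⟨ +-monoʳ-≤ (2 * v) (bit≤1 (lookup x k)) ⟩
      2 * v + 1                 <⟨ +-monoʳ-< (2 * v) (s≤s (s≤s z≤n)) ⟩
      2 * v + 2                 ≡⟨ +-comm (2 * v) 2 ⟩
      2 + 2 * v                 ≡⟨ *-suc 2 v ⟨
      -- Strictness of v < 2 ^ k gives suc v ≤ 2 ^ k, which leaves room for the new bit.
      2 * suc v                 ≤⟨ *-monoʳ-≤ 2 v< ⟩
      2 * 2 ^ toℕ k             ∎
      where open ≤-Reasoning

  -- The nested loops: walking through the matrices and output

  start : Fin n → Fin n × Fin n
  start i = hash (row i) n x , hash (col i) n x

  path : Fin n → ℕ → Fin n × Fin n
  path i k = foldl (step κ x i) (start i) (take k (allFin n))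

  path-n : ∀ i → path i n ≡ walk κ x i
  path-n i = cong (foldl (step κ x i) (start i)) (take-tabulate (λ i → i))

  outputBit : Fin n → ℤ
  outputBit i = + bit (M i (proj₁ (walk κ x i)) (proj₂ (walk κ x i)))

  -- The register `rk` and the output are parameters, as the walk must hand them back unchanged to
  -- the outer loop; `rj` and `rd` are rewritten before each use.
  WalkInv : Fin n → ℤ → List ℤ → ℕ → State → Set
  WalkInv i k out j s = ∃[ j′ ] ∃[ d′ ]
    s ≡ registers (+ value x) (position i) j′ k
          (position (proj₁ (path i j))) (position (proj₂ (path i j))) d′ out

  walkBody : Cmd
  walkBody =
      rd ≔ hashExpr hdA hdB hdP (reg ri ∷ reg rj ∷ []) (lit (+ 8)) ⊕ lit 1ℤ
    ⨾ rr ≔ reg rr ⊕ arrD [ reg rd ∷ lit 1ℤ ∷ [] ]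
    ⨾ rc ≔ reg rc ⊕ arrD [ reg rd ∷ lit (+ 2) ∷ [] ]
    ⨾ wrapCmd rr
    ⨾ wrapCmd rc

  walk-step : ∀ i k out (j : Fin n) {s} → WalkInv i k out (toℕ j) s →
    WP walkBody (WalkInv i k out (suc (toℕ j))) (set rj (+ suc (toℕ j)) s)
  walk-step i k out j (_ , _ , refl) =
    wp-seq (wp-assign (+ suc (toℕ d))
      (hash-correct h 8 x (entry LinearHash.a) (entry LinearHash.b) (entry LinearHash.p))
      (≤8+n⇒≤2^w (≤-trans (toℕ<n d) (m≤m+n 8 n)))
    (wp-seq (wp-assign _ (cong (ℤ._+_ (position r)) (moveBy zero)) (D≤2^w r d zero)
    (wp-seq (wp-assign _ (cong (ℤ._+_ (position c)) (moveBy (suc zero))) (D≤2^w c d (suc zero))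
    -- The two wraps touch different registers, so after both additions they amount to `move` in
    -- each coordinate, which is one application of `step`.
    (wp-seq (wp-wrap rr refl (wp-wrap rc refl
      (_ , _ , cong (λ p → registers _ _ _ _ (position (proj₁ p)) (position (proj₂ p))
                               (+ suc (toℕ d)) out)
                    (sym (foldl-take-suc (step κ x i) (start i) j)))))))))))
    where
    h = hd (i , j)
    d = hash h 8 x
    r = proj₁ (path i (toℕ j))
    c = proj₂ (path i (toℕ j))

    entry : ∀ (f : LinearHash n → ℕ) →
      at (λ i → at (λ j → + f (hd (i , j))) (position j)) (position i) ≡ + f h
    entry f = trans (at-toℕ _ i) (at-toℕ _ j)

    -- The column literals 1 and 2 of the program are the 1-based forms of the two elements l of
    -- `Fin 2`.
    moveBy : ∀ l →
      at (λ d → at (lookup (lookup D d)) (+ suc (toℕ l))) (+ suc (toℕ d)) ≡ lookup (lookup D d) l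
    moveBy l = trans (at-toℕ _ d) (at-toℕ (lookup (lookup D d)) l)

  -- Only `rn`, `rx` and the output carry information from one round to the next.
  OutputInv : ℕ → State → Set
  OutputInv i s = ∃[ i′ ] ∃[ j′ ] ∃[ k′ ] ∃[ r′ ] ∃[ c′ ] ∃[ d′ ]
    s ≡ registers (+ value x) i′ j′ k′ r′ c′ d′ (take i (List.tabulate outputBit))

  outputBody : Cmd
  outputBody =
      rr ≔ hashExpr rowA rowB rowP (reg ri ∷ []) (reg rn) ⊕ lit 1ℤ
    ⨾ rc ≔ hashExpr colA colB colP (reg ri ∷ []) (reg rn) ⊕ lit 1ℤ
    ⨾ for rj (reg rn) walkBody
    ⨾ append (arrM [ reg ri ∷ reg rr ∷ reg rc ∷ [] ])

  output-step : ∀ (i : Fin n) {s} → OutputInv (toℕ i) s →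
    WP outputBody (OutputInv (suc (toℕ i))) (set ri (+ suc (toℕ i)) s)
  output-step i (_ , _ , k′ , _ , _ , _ , refl) =
    wp-seq (wp-assign (position (proj₁ (start i)))
      (hash-correct (row i) n x (at-toℕ _ i) (at-toℕ _ i) (at-toℕ _ i))
      (position≤2^w _)
    (wp-seq (wp-assign (position (proj₂ (start i)))
      (hash-correct (col i) n x (at-toℕ _ i) (at-toℕ _ i) (at-toℕ _ i))
      (position≤2^w _)
    -- Initially `path i 0` computes to `start i`, the fold over an empty prefix.
    (wp-seq (wp-for (WalkInv i k′ out) refl (_ , _ , refl) (walk-step i k′ out)
      λ { (_ , _ , refl) → wp-append (outputBit i) entry
        ( _ , _ , _ , _ , _ , _
        , cong (registers _ _ _ _ _ _ _) (sym (take-suc-tabulate outputBit i))) })))))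
    where
    out = take (toℕ i) (List.tabulate outputBit)

    readM : ∀ r c →
      at (λ i → at (λ r → at (λ c → + bit (M i r c)) (position c)) (position r)) (position i)
        ≡ + bit (M i r c)
    readM r c = trans (at-toℕ _ i)
      (trans (at-toℕ (λ r → at (λ c → + bit (M i r c)) (position c)) r)
             (at-toℕ (λ c → + bit (M i r c)) c))

    -- The zeros and the empty output are placeholders: the read depends on `ri`, `rr` and `rc`
    -- only, so it agrees by computation with the read in the actual state.
    entry : eval (arrays κ x) (arrM [ reg ri ∷ reg rr ∷ reg rc ∷ [] ])
              (registers 0ℤ (position i) 0ℤ 0ℤ (position (proj₁ (path i n)))
                 (position (proj₂ (path i n))) 0ℤ [])
            ≡ outputBit i
    entry rewrite path-n i = readM (proj₁ (walk κ x i)) (proj₂ (walk κ x i))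

  program-wp : WP program (λ s → output s ≡ List.tabulate outputBit)
                  (registers 0ℤ 0ℤ 0ℤ 0ℤ 0ℤ 0ℤ 0ℤ [])
  program-wp =
    wp-seq (wp-assign 0ℤ refl z≤n
    (wp-seq (wp-for ReadInv refl (_ , refl , s≤s z≤n) read-step
      λ { (_ , refl , _) →
        wp-for OutputInv refl
          -- At the end of the first loop `rx` holds the value of the full prefix, which is that of
          -- `x`.
          (_ , _ , _ , _ , _ , _ , cong (λ v → registers (+ v) _ _ _ _ _ _ []) prefixValue-n)
          output-step
          λ { (_ , _ , _ , _ , _ , _ , refl) → take-tabulate outputBit } })))

  output≡ : List.map (λ y → + bit y) (toList (⟦ κ ⟧ x)) ≡ List.tabulate outputBit
  output≡ = trans (cong (List.map _) (toList-tabulate _)) (map-tabulate _ _)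

  program-run :
    output (Algorithm.run (A κ) x) ≡ List.map (λ y → + bit y) (toList (⟦ κ ⟧ x)) ×
    Algorithm.runningTime (A κ) x ≤ evalPoly (timeₚ program) n
  program-run =
    let out , _ , t = program-wp .run
          (≤8+n⇒≤2^w (m≤n+m n 8) ∷ z≤n ∷ z≤n ∷ z≤n ∷ z≤n ∷ z≤n ∷ z≤n ∷ z≤n ∷ [])
    in trans out (sym output≡) , t .bound

-- The polynomial can be chosen before n and τ because `timeₚ` inspects only `program`, which is the
-- same for all of them.
lemma1 : Σ Polynomial λ P →
    ∀ (n : ℕ) .{{_ : NonZero n}} (τ : Bits n → Bits n) (τ∈T : τ ∈ T n) →
    A (proj₁ τ∈T) Computes τ Within evalPoly P n
lemma1 = timeₚ program , λ n τ (κ , τ≗) → record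
  { correct = λ x → trans (program-run κ x .proj₁)
      (cong (List.map (λ y → + bit y) ∘ toList) (sym (τ≗ x)))
  ; fast    = λ x → program-run κ x .proj₂
  }
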